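{- Let $d\ge 2$ be a constant. If $G$ is a tree with $n$ vertices and maximum vertex degree $d$, then $$D_2(G) < c_d\log n + d + 2,\qquad\text{where } c_d=\frac{d+1}{\log(3/2)}+1.$$
   Context: All graphs are finite simple graphs. A graph is regarded as a structure with one anti-reflexive symmetric binary relation $E$ (adjacency). First-order formulas are over the vocabulary $\{E,=\}$, with connectives $\neg,\wedge,\vee$ and quantifiers $\exists,\forall$. The quantifier rank of a formula is the maximum number of nested quantifiers in it. For a formula $\Phi$, its set of sequences of nested quantifiers $\mathrm{nest}(\Phi)$ (words over $\{\exists,\forall\}$) is defined inductively: - $\mathrm{nest}(\Phi)=\{\text{empty word}\}$ for atomic $\Phi$; - $\mathrm{nest}(\neg\Phi)$ is $\mathrm{nest}(\Phi)$ with $\exists$ and $\forall$ interchanged in every word; - $\mathrm{nest}(\Phi\wedge\Psi)=\mathrm{nest}(\Phi\vee\Psi)=\mathrm{nest}(\Phi)\cup\mathrm{nest}(\Psi)$; - $\mathrm{nest}(\exists x\Phi)=\exists\,\mathrm{nest}(\Phi)$ and $\mathrm{nest}(\forall x\Phi)=\forall\,\mathrm{nest}(\Phi)$. The alternation number of $\Phi$ is the maximum, over words $s\in\mathrm{nest}(\Phi)$, of the number of occurrences of $\exists\forall$ and $\forall\exists$ as consecutive letters in $s$. A closed formula $\Phi$ defines a graph $G$ if $\Phi$ is true on $G$ and false on every graph not isomorphic to $G$. $D_k(G)$ denotes the minimum quantifier rank of a formula with alternation number at most $k$ that defines $G$. $\log$ denotes the logarithm to base 2. -}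

module Defs where

open import Data.Nat using (ℕ; zero; suc; _+_; _*_; _^_; _≤_; _<_; _⊔_)
open import Data.Bool using (Bool; true; false; if_then_else_; not; _∧_; _∨_)
open import Data.Fin using (Fin; _≟_)
open import Data.List using (List; []; _∷_; _++_; map; foldr; length; allFin)
open import Data.Bool.ListAction using (any; all)
open import Data.Nat.ListAction using (sum)
open import Data.List.Relation.Unary.Unique.Propositional using (Unique)
open import Data.Product using (Σ; _×_; ∃-syntax)
open import Data.Unit using (⊤)
open import Data.Empty using (⊥)
open import Relation.Nullary using (¬_)
open import Relation.Nullary.Decidable using (⌊_⌋)
open import Relation.Binary.PropositionalEquality using (_≡_)
open import Function.Bundles using (_↔_; Inverse)

record Graph (n : ℕ) : Set where
  field
    E      : Fin n → Fin n → Bool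
    sym    : ∀ u v → E u v ≡ E v u
    irrefl : ∀ v → E v v ≡ false
open Graph public

record _≅_ {m n : ℕ} (H : Graph m) (G : Graph n) : Set where
  field
    bij      : Fin m ↔ Fin n
    preserve : ∀ u v → E H u v ≡ E G (Inverse.to bij u) (Inverse.to bij v)

-- First-order formulas over {E, =}; free variables are Fin k (de Bruijn,
-- index 0 = innermost bound variable).  Closed formulas : Formula 0.

data Formula : ℕ → Set where
  atE  : ∀ {k} → Fin k → Fin k → Formula k
  atEq : ∀ {k} → Fin k → Fin k → Formula k
  neg  : ∀ {k} → Formula k → Formula k
  conj : ∀ {k} → Formula k → Formula k → Formula k
  disj : ∀ {k} → Formula k → Formula k → Formula k
  ex   : ∀ {k} → Formula (suc k) → Formula k
  all' : ∀ {k} → Formula (suc k) → Formula k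

_◂_ : ∀ {k n} → Fin n → (Fin k → Fin n) → Fin (suc k) → Fin n
(v ◂ ρ) Fin.zero    = v
(v ◂ ρ) (Fin.suc i) = ρ i

eval : ∀ {n k} → Graph n → (Fin k → Fin n) → Formula k → Bool
eval G ρ (atE x y)  = E G (ρ x) (ρ y)
eval G ρ (atEq x y) = ⌊ ρ x ≟ ρ y ⌋
eval G ρ (neg φ)    = not (eval G ρ φ)
eval G ρ (conj φ ψ) = eval G ρ φ ∧ eval G ρ ψ
eval G ρ (disj φ ψ) = eval G ρ φ ∨ eval G ρ ψ
eval {n} G ρ (ex φ)   = any (λ v → eval G (v ◂ ρ) φ) (allFin n)
eval {n} G ρ (all' φ) = all (λ v → eval G (v ◂ ρ) φ) (allFin n)

noVars : ∀ {n} → Fin 0 → Fin n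
noVars ()

_⊨_ : ∀ {n} → Graph n → Formula 0 → Bool
G ⊨ Φ = eval G noVars Φ

qr : ∀ {k} → Formula k → ℕ
qr (atE _ _)  = 0
qr (atEq _ _) = 0
qr (neg φ)    = qr φ
qr (conj φ ψ) = qr φ ⊔ qr ψ
qr (disj φ ψ) = qr φ ⊔ qr ψ
qr (ex φ)     = suc (qr φ)
qr (all' φ)   = suc (qr φ)

data Q : Set where
  qE qA : Q

swapQ : Q → Q
swapQ qE = qA
swapQ qA = qE

nest : ∀ {k} → Formula k → List (List Q)
nest (atE _ _)  = [] ∷ []
nest (atEq _ _) = [] ∷ []
nest (neg φ)    = map (map swapQ) (nest φ)
nest (conj φ ψ) = nest φ ++ nest ψ
nest (disj φ ψ) = nest φ ++ nest ψ
nest (ex φ)     = map (qE ∷_) (nest φ)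
nest (all' φ)   = map (qA ∷_) (nest φ)

differ : Q → Q → ℕ
differ qE qA = 1
differ qA qE = 1
differ _  _  = 0

alternations : List Q → ℕ
alternations (a ∷ b ∷ w) = differ a b + alternations (b ∷ w)
alternations _           = 0

altNum : ∀ {k} → Formula k → ℕ
altNum φ = foldr _⊔_ 0 (map alternations (nest φ))

Defines : ∀ {n} → Formula 0 → Graph n → Set
Defines {n} Φ G = (G ⊨ Φ ≡ true) × (∀ m (H : Graph m) → H ⊨ Φ ≡ true → H ≅ G)

data Walk {n} (G : Graph n) : Fin n → Fin n → Set where
  here : ∀ {u} → Walk G u u
  step : ∀ {u w v} → E G u w ≡ true → Walk G w v → Walk G u v

Connected : ∀ {n} → Graph n → Set
Connected {n} G = ∀ (u v : Fin n) → Walk G u v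

Chain : ∀ {n} → Graph n → List (Fin n) → Set
Chain G (a ∷ b ∷ w) = (E G a b ≡ true) × Chain G (b ∷ w)
Chain G _           = ⊤

HasCycle : ∀ {n} → Graph n → Set
HasCycle {n} G = Σ (Fin n) λ v → Σ (List (Fin n)) λ rest →
  (2 ≤ length rest) × Unique (v ∷ rest) × Chain G (v ∷ rest ++ v ∷ [])

IsTree : ∀ {n} → Graph n → Set
IsTree G = Connected G × ¬ HasCycle G

deg : ∀ {n} → Graph n → Fin n → ℕ
deg {n} G v = sum (map (λ u → if E G v u then 1 else 0) (allFin n))

MaxDegree : ∀ {n} → Graph n → ℕ → Set
MaxDegree {n} G d = (∃[ v ] deg G v ≡ d) × (∀ (v : Fin n) → deg G v ≤ d)

-- The real inequality  D < c_d·log₂ n + d + 2,  c_d = (d+1)/log₂(3/2) + 1,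
-- i.e.  D < (d+1)·log_{3/2} n + log₂ n + d + 2,  expressed over ℕ:
-- there are rationals p = r₁/s ≤ log_{3/2} n  (⇔ 3^r₁ ≤ n^s·2^r₁) and
-- q = r₂/s ≤ log₂ n (⇔ 2^r₂ ≤ n^s) with D < (d+1)p + q + d + 2.
-- (Equivalent to the real inequality by density of ℚ, since the logs are ≥ 0.)
BelowBound : (d n D : ℕ) → Set
BelowBound d n D = ∃[ r₁ ] ∃[ r₂ ] ∃[ s ]
  (1 ≤ s) × (3 ^ r₁ ≤ n ^ s * 2 ^ r₁) × (2 ^ r₂ ≤ n ^ s) ×
  (D * s < (d + 1) * r₁ + r₂ + (d + 2) * s)

-- The sentence says that H is connected and that there is a covering map from G to H.  A connected graph
-- covered by a finite tree is isomorphic to it: two vertices of the tree in one fibre would yield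
-- nonbacktracking walks in it of unbounded length, by lifting again and again.  The covering map is guessed
-- by naming a median v of the remaining vertex set C together with its at most d neighbours, then treating
-- the branches of the tree at v separately.  Since a median minimises the total distance to C, each branch
-- contains at most half of C, so ⌊log₂ n⌋ + 1 rounds of d + 1 existential quantifiers suffice; a final
-- universal quantifier says that the named vertices have no further neighbours.

module Submission where

open import Defs
open import Data.Nat using (ℕ; _≤_)
open import Data.Product using (_×_; ∃-syntax)
open import Data.Nat using (zero; suc; _+_; _*_; _^_; _<_; _⊔_; z≤n; s≤s; _<?_; _≤?_)
open import Data.Nat.Properties hiding (_≟_)
open import Data.Bool using (Bool; true; false; T; if_then_else_; _∧_)
open import Data.Bool.Properties using (T-≡; T-not-≡; T-∧; T-∨) renaming (_≟_ to _≟ᵇ_)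
open import Data.Fin using (Fin; _≟_; _↑ˡ_; _↑ʳ_) renaming (zero to fzero; suc to fsuc)
open import Data.Fin.Properties using (injective⇒≤) renaming (any? to anyFin?)
open import Data.List using (List; []; _∷_; _++_; map; foldr; length; allFin; filterᵇ; lookup)
open import Data.List.Extrema.Nat using (argmin; f[argmin]≤f[xs])
open import Data.List.Membership.Propositional using (_∈_; lose)
open import Data.List.Membership.Propositional.Properties using (∈-∃++; ∈-allFin; ∈-filter⁺; ∈-lookup)
open import Data.List.Relation.Unary.All as All using (All; []; _∷_)
open import Data.List.Relation.Unary.All.Properties as All using (all⁺; all⁻)
open import Data.List.Relation.Unary.AllPairs as AllPairs using ([]; _∷_)
open import Data.List.Relation.Unary.Any as Any using (here; there)
open import Data.List.Relation.Unary.Any.Properties using (any⁺; any⁻)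
open import Data.List.Relation.Unary.Unique.Propositional using (Unique)
open import Data.Nat.ListAction using () renaming (sum to sumᴸ)
open import Algebra.Properties.CommutativeMonoid.Sum +-0-commutativeMonoid using (sum; ∑-distrib-+)
open import Data.Product using (_,_; proj₁; proj₂)
open import Data.Sum using (_⊎_; inj₁; inj₂)
open import Data.Empty using (⊥; ⊥-elim)
open import Data.Unit using (tt)
open import Data.Nat.Solver using (module +-*-Solver)
open import Function using (_∘_)
open import Function.Bundles using (Equivalence; mk↔ₛ′)
open import Relation.Nullary using (¬_; Dec; yes; no; contradiction)
open import Relation.Nullary.Decidable using (⌊_⌋; toWitness; fromWitness; _×-dec_; T?)
open import Relation.Binary.PropositionalEquality as ≡ using (_≡_; _≢_; refl; cong; cong₂; subst)

open Equivalence using (to; from)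
open +-*-Solver using (solve; _:+_; _:*_; _:=_; con)

-- Auxiliary facts on numbers, sums and lists.

least : {P : ℕ → Set} → (∀ k → Dec (P k)) → ∀ k → P k → ∃[ j ] (P j × (∀ i → P i → j ≤ i))
least P? zero p = 0 , p , λ _ _ → z≤n
least P? (suc k) p with P? 0
... | yes p₀ = 0 , p₀ , λ _ _ → z≤n
... | no ¬p₀ with least (P? ∘ suc) k p
...   | j , q , min = suc j , q , λ { zero p₀ → contradiction p₀ ¬p₀ ; (suc i) pᵢ → s≤s (min i pᵢ) }

sum-mono-≤ : ∀ {n} {f g : Fin n → ℕ} → (∀ i → f i ≤ g i) → sum f ≤ sum g
sum-mono-≤ {zero}  f≤g = z≤n
sum-mono-≤ {suc n} f≤g = +-mono-≤ (f≤g fzero) (sum-mono-≤ (f≤g ∘ fsuc))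

sum-zero : ∀ {n} {f : Fin n → ℕ} → (∀ i → f i ≡ 0) → sum f ≡ 0
sum-zero {zero}  f≡0 = refl
sum-zero {suc n} f≡0 = cong₂ _+_ (f≡0 fzero) (sum-zero (f≡0 ∘ fsuc))

f≤sum : ∀ {n} (f : Fin n → ℕ) i → f i ≤ sum f
f≤sum f fzero    = m≤m+n _ _
f≤sum f (fsuc i) = m≤n⇒m≤o+n (f fzero) (f≤sum (f ∘ fsuc) i)

binaryLog : ∀ n → 1 ≤ n → ∃[ L ] (2 ^ L ≤ n × n < 2 ^ suc L)
binaryLog 1 _ = 0 , ≤-refl , ≤-refl
binaryLog (suc (suc n)) _ with binaryLog (suc n) (s≤s z≤n)
... | L , lo , hi with suc (suc n) <? 2 ^ suc L
...   | yes lt = L , m≤n⇒m≤1+n lo , lt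
...   | no ≮   = suc L , ≮⇒≥ ≮ , ≤-<-trans hi (^-monoʳ-< 2 ≤-refl (n<1+n (suc L)))

indicator : Bool → ℕ
indicator b = if b then 1 else 0

length-filterᵇ : ∀ {A : Set} (p : A → Bool) xs → length (filterᵇ p xs) ≡ sumᴸ (map (indicator ∘ p) xs)
length-filterᵇ p [] = refl
length-filterᵇ p (x ∷ xs) with p x
... | true  = cong suc (length-filterᵇ p xs)
... | false = length-filterᵇ p xs

pad : ∀ {A : Set} → A → List A → ∀ d → Fin d → A
pad a []       d       i        = a
pad a (x ∷ xs) (suc d) fzero    = x
pad a (x ∷ xs) (suc d) (fsuc i) = pad a xs d i

∈-pad : ∀ {A : Set} {a y : A} {xs} d → length xs ≤ d → y ∈ xs → ∃[ i ] pad a xs d i ≡ y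
∈-pad (suc d) (s≤s le) (here refl) = fzero , refl
∈-pad (suc d) (s≤s le) (there y∈) with ∈-pad d le y∈
... | i , eq = fsuc i , eq

-- Formulas

-- A record around `T (eval G ρ φ)`, so that unification can read off `G`, `ρ` and `φ` from the type
-- of a proof, which is not possible through `eval`.
record Sat {n k} (G : Graph n) (ρ : Fin k → Fin n) (φ : Formula k) : Set where
  constructor sat
  field holds : T (eval G ρ φ)
open Sat

module _ {n k} {G : Graph n} {ρ : Fin k → Fin n} where

  conj⁺ : ∀ {φ ψ} → Sat G ρ φ → Sat G ρ ψ → Sat G ρ (conj φ ψ)
  conj⁺ (sat s) (sat t) = sat (from T-∧ (s , t))

  conj⁻ : ∀ {φ ψ} → Sat G ρ (conj φ ψ) → Sat G ρ φ × Sat G ρ ψ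
  conj⁻ (sat s) = let t , u = to T-∧ s in sat t , sat u

  disj⁺ : ∀ {φ ψ} → Sat G ρ φ ⊎ Sat G ρ ψ → Sat G ρ (disj φ ψ)
  disj⁺ (inj₁ (sat s)) = sat (from T-∨ (inj₁ s))
  disj⁺ {φ} (inj₂ (sat s)) = sat (from (T-∨ {eval G ρ φ}) (inj₂ s))

  disj⁻ : ∀ {φ ψ} → Sat G ρ (disj φ ψ) → Sat G ρ φ ⊎ Sat G ρ ψ
  disj⁻ {φ} (sat s) with to (T-∨ {eval G ρ φ}) s
  ... | inj₁ t = inj₁ (sat t)
  ... | inj₂ t = inj₂ (sat t)

  ex⁺ : ∀ {φ} v → Sat G (v ◂ ρ) φ → Sat G ρ (ex φ)
  ex⁺ v (sat s) = sat (any⁺ _ (lose (∈-allFin v) s))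

  ex⁻ : ∀ {φ} → Sat G ρ (ex φ) → ∃[ v ] Sat G (v ◂ ρ) φ
  ex⁻ (sat s) = let v , t = Any.satisfied (any⁻ _ (allFin n) s) in v , sat t

  all'⁺ : ∀ {φ} → (∀ v → Sat G (v ◂ ρ) φ) → Sat G ρ (all' φ)
  all'⁺ s = sat (all⁻ _ (All.universal (holds ∘ s) (allFin n)))

  all'⁻ : ∀ {φ} → Sat G ρ (all' φ) → ∀ v → Sat G (v ◂ ρ) φ
  all'⁻ (sat s) v = sat (All.lookup (all⁺ _ (allFin n) s) (∈-allFin v))

  atE⁺ : ∀ {i j} → E G (ρ i) (ρ j) ≡ true → Sat G ρ (atE i j)
  atE⁺ e = sat (from T-≡ e)

  atE⁻ : ∀ {i j} → Sat G ρ (atE i j) → E G (ρ i) (ρ j) ≡ true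
  atE⁻ (sat s) = to T-≡ s

  atEq⁺ : ∀ {i j} → ρ i ≡ ρ j → Sat G ρ (atEq i j)
  atEq⁺ {i} {j} eq = sat (fromWitness {a? = ρ i ≟ ρ j} eq)

  atEq⁻ : ∀ {i j} → Sat G ρ (atEq i j) → ρ i ≡ ρ j
  atEq⁻ (sat s) = toWitness s

-- There is no closed quantifier-free formula, so even truth costs one quantifier.
⊤' : ∀ {k} → Formula k
⊤' = all' (atEq fzero fzero)

⋀ : ∀ {k} N → (Fin N → Formula k) → Formula k
⋀ zero    φ = ⊤'
⋀ (suc N) φ = conj (φ fzero) (⋀ N (φ ∘ fsuc))

-- The given `β` serves as the empty disjunction, so that no quantifier is spent on expressing
-- falsity.
⋁ : ∀ {k} → Formula k → ∀ N → (Fin N → Formula k) → Formula k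
⋁ β zero    φ = β
⋁ β (suc N) φ = disj (φ fzero) (⋁ β N (φ ∘ fsuc))

literal : ∀ {k} → Bool → Formula k → Formula k
literal true  φ = φ
literal false φ = neg φ

exs : ∀ m {k} → Formula (m + k) → Formula k
exs zero    φ = φ
exs (suc m) φ = exs m (ex φ)

extend : ∀ {m k} {n} → (Fin m → Fin n) → (Fin k → Fin n) → Fin (m + k) → Fin n
extend {zero}  σ ρ = ρ
extend {suc m} σ ρ = σ fzero ◂ extend (σ ∘ fsuc) ρ

extend-↑ˡ : ∀ {m k} {n} (σ : Fin m → Fin n) (ρ : Fin k → Fin n) i → extend σ ρ (i ↑ˡ k) ≡ σ i
extend-↑ˡ σ ρ fzero    = refl
extend-↑ˡ σ ρ (fsuc i) = extend-↑ˡ (σ ∘ fsuc) ρ i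

extend-↑ʳ : ∀ m {k} {n} (σ : Fin m → Fin n) (ρ : Fin k → Fin n) i → extend σ ρ (m ↑ʳ i) ≡ ρ i
extend-↑ʳ zero    σ ρ i = refl
extend-↑ʳ (suc m) σ ρ i = extend-↑ʳ m (σ ∘ fsuc) ρ i


module _ {n k} {G : Graph n} {ρ : Fin k → Fin n} where

  ⊤'⁺ : Sat G ρ ⊤'
  ⊤'⁺ = all'⁺ λ _ → atEq⁺ refl

  ⋀⁺ : ∀ N {φ : Fin N → Formula k} → (∀ i → Sat G ρ (φ i)) → Sat G ρ (⋀ N φ)
  ⋀⁺ zero    s = ⊤'⁺
  ⋀⁺ (suc N) s = conj⁺ (s fzero) (⋀⁺ N (s ∘ fsuc))

  ⋀⁻ : ∀ N {φ : Fin N → Formula k} → Sat G ρ (⋀ N φ) → ∀ i → Sat G ρ (φ i)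
  ⋀⁻ (suc N) s fzero    = proj₁ (conj⁻ s)
  ⋀⁻ (suc N) s (fsuc i) = ⋀⁻ N (proj₂ (conj⁻ s)) i

  ⋁⁺₀ : ∀ {β} N {φ : Fin N → Formula k} → Sat G ρ β → Sat G ρ (⋁ β N φ)
  ⋁⁺₀ zero    s = s
  ⋁⁺₀ (suc N) s = disj⁺ (inj₂ (⋁⁺₀ N s))

  ⋁⁺ : ∀ {β} N {φ : Fin N → Formula k} i → Sat G ρ (φ i) → Sat G ρ (⋁ β N φ)
  ⋁⁺ (suc N) fzero    s = disj⁺ (inj₁ s)
  ⋁⁺ (suc N) (fsuc i) s = disj⁺ (inj₂ (⋁⁺ N i s))

  ⋁⁻ : ∀ {β} N {φ : Fin N → Formula k} → Sat G ρ (⋁ β N φ) → Sat G ρ β ⊎ ∃[ i ] Sat G ρ (φ i)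
  ⋁⁻ zero    s = inj₁ s
  ⋁⁻ (suc N) s with disj⁻ s
  ... | inj₁ s₀ = inj₂ (fzero , s₀)
  ... | inj₂ s′ with ⋁⁻ N s′
  ...   | inj₁ b       = inj₁ b
  ...   | inj₂ (i , t) = inj₂ (fsuc i , t)

  literal⁺ : ∀ {b φ} → eval G ρ φ ≡ b → Sat G ρ (literal b φ)
  literal⁺ {true}  eq = sat (from T-≡ eq)
  literal⁺ {false} eq = sat (from T-not-≡ eq)

  literal⁻ : ∀ b {φ} → Sat G ρ (literal b φ) → eval G ρ φ ≡ b
  literal⁻ true  (sat s) = to T-≡ s
  literal⁻ false (sat s) = to T-not-≡ s

exs⁺ : ∀ m {n k} {G : Graph n} {ρ : Fin k → Fin n} {φ} σ → Sat G (extend {m} σ ρ) φ → Sat G ρ (exs m φ)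
exs⁺ zero    σ s = s
exs⁺ (suc m) σ s = exs⁺ m (σ ∘ fsuc) (ex⁺ (σ fzero) s)

exs⁻ : ∀ m {n k} {G : Graph n} {ρ : Fin k → Fin n} {φ} → Sat G ρ (exs m φ) → ∃[ σ ] Sat G (extend {m} σ ρ) φ
exs⁻ zero    s = (λ ()) , s
exs⁻ (suc m) s with exs⁻ m s
... | σ , s′ with ex⁻ s′
...   | v , s″ = (v ◂ σ) , s″

-- Quantifier rank and words of nested quantifiers.

qr-literal : ∀ {k} b {φ : Formula k} → qr (literal b φ) ≡ qr φ
qr-literal true  = refl
qr-literal false = refl

qr-exs : ∀ m {k} (φ : Formula (m + k)) → qr (exs m φ) ≡ m + qr φ
qr-exs zero    φ = refl
qr-exs (suc m) φ = ≡.trans (qr-exs m (ex φ)) (+-suc m (qr φ))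

-- The condition `1 ≤ b` pays for `⊤'`, the empty conjunction, which has rank 1.
qr-⋀ : ∀ {k b} N {φ : Fin N → Formula k} → 1 ≤ b → (∀ i → qr (φ i) ≤ b) → qr (⋀ N φ) ≤ b
qr-⋀ zero    1≤b le = 1≤b
qr-⋀ (suc N) 1≤b le = ⊔-lub (le fzero) (qr-⋀ N 1≤b (le ∘ fsuc))

qr-⋁ : ∀ {k b β} N {φ : Fin N → Formula k} → qr β ≤ b → (∀ i → qr (φ i) ≤ b) → qr (⋁ β N φ) ≤ b
qr-⋁ zero    qβ le = qβ
qr-⋁ (suc N) qβ le = ⊔-lub (le fzero) (qr-⋁ N qβ (le ∘ fsuc))

-- The regular language a*b*. It is closed under prepending `a`, which is all that an added leading
-- quantifier does.
data TwoBlocks (a b : Q) : List Q → Set where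
  base : ∀ {w} → All (_≡ b) w → TwoBlocks a b w
  _∷_  : ∀ {q w} → q ≡ a → TwoBlocks a b w → TwoBlocks a b (q ∷ w)

differ-refl : ∀ a → differ a a ≡ 0
differ-refl qE = refl
differ-refl qA = refl

differ≤1 : ∀ a b → differ a b ≤ 1
differ≤1 qE qE = z≤n
differ≤1 qE qA = ≤-refl
differ≤1 qA qE = ≤-refl
differ≤1 qA qA = z≤n

alternations-const : ∀ {b w} → All (_≡ b) w → alternations w ≡ 0
alternations-const []                   = refl
alternations-const (refl ∷ [])          = refl
alternations-const {b} (refl ∷ refl ∷ w) = cong₂ _+_ (differ-refl b) (alternations-const (refl ∷ w))

alternations-TwoBlocks : ∀ {a b w} → TwoBlocks a b w → alternations w ≤ 1
alternations-TwoBlocks (base w) = ≤-trans (≤-reflexive (alternations-const w)) z≤n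
alternations-TwoBlocks (refl ∷ base []) = z≤n
alternations-TwoBlocks {a} {b} (refl ∷ base (refl ∷ w)) =
  ≤-trans (+-mono-≤ (differ≤1 a b) (≤-reflexive (alternations-const (refl ∷ w)))) ≤-refl
alternations-TwoBlocks {a} (refl ∷ refl ∷ t) =
  +-mono-≤ (≤-reflexive (differ-refl a)) (alternations-TwoBlocks (refl ∷ t))

record Nests {k} (P : List Q → Set) (φ : Formula k) : Set where
  constructor nests
  field words : All P (nest φ)

altNum≤ : ∀ {k b} {φ : Formula k} → Nests (λ w → alternations w ≤ b) φ → altNum φ ≤ b
altNum≤ {b = b} (nests ps) = go ps
  where
  go : ∀ {ws} → All (λ w → alternations w ≤ b) ws → foldr _⊔_ 0 (map alternations ws) ≤ b
  go []       = z≤n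
  go (p ∷ ps) = ⊔-lub p (go ps)

nest-map : ∀ {P R : List Q → Set} {k} {φ : Formula k} → (∀ {w} → P w → R w) → Nests P φ → Nests R φ
nest-map f (nests ps) = nests (All.map f ps)

Constant : Q → List Q → Set
Constant q = All (_≡ q)

module _ {P : List Q → Set} where

  nest-conj : ∀ {k} {φ ψ : Formula k} → Nests P φ → Nests P ψ → Nests P (conj φ ψ)
  nest-conj (nests p) (nests q) = nests (All.++⁺ p q)

  nest-disj : ∀ {k} {φ ψ : Formula k} → Nests P φ → Nests P ψ → Nests P (disj φ ψ)
  nest-disj (nests p) (nests q) = nests (All.++⁺ p q)

  nest-ex : ∀ {R : List Q → Set} {k} {φ : Formula (suc k)} →
    (∀ {w} → R w → P (qE ∷ w)) → Nests R φ → Nests P (ex φ)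
  nest-ex p (nests ps) = nests (All.map⁺ (All.map p ps))

  nest-all' : ∀ {R : List Q → Set} {k} {φ : Formula (suc k)} →
    (∀ {w} → R w → P (qA ∷ w)) → Nests R φ → Nests P (all' φ)
  nest-all' p (nests ps) = nests (All.map⁺ (All.map p ps))

  nest-atE : ∀ {k} {x y : Fin k} b → P [] → Nests P (literal b (atE x y))
  nest-atE true  p = nests (p ∷ [])
  nest-atE false p = nests (p ∷ [])

  nest-atEq : ∀ {k} {x y : Fin k} b → P [] → Nests P (literal b (atEq x y))
  nest-atEq true  p = nests (p ∷ [])
  nest-atEq false p = nests (p ∷ [])

  nest-⋀ : ∀ {k} N {φ : Fin N → Formula k} → P (qA ∷ []) → (∀ i → Nests P (φ i)) → Nests P (⋀ N φ)
  nest-⋀ zero    p ps = nests (p ∷ [])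
  nest-⋀ (suc N) p ps = nest-conj (ps fzero) (nest-⋀ N p (ps ∘ fsuc))

  nest-⋁ : ∀ {k β} N {φ : Fin N → Formula k} → Nests P β → (∀ i → Nests P (φ i)) → Nests P (⋁ β N φ)
  nest-⋁ zero    p ps = p
  nest-⋁ (suc N) p ps = nest-disj (ps fzero) (nest-⋁ N p (ps ∘ fsuc))

  nest-exs : ∀ m {k} {φ : Formula (m + k)} → (∀ {w} → P w → P (qE ∷ w)) → Nests P φ → Nests P (exs m φ)
  nest-exs zero    p ps = ps
  nest-exs (suc m) p ps = nest-exs m p (nest-ex p ps)

-- Distances up to 2^k with k quantifiers, by guessing the midpoint.
near : ∀ {j} → ℕ → Fin j → Fin j → Formula j
near zero    x y = disj (atEq x y) (atE x y)
near (suc k) x y = ex (conj (near k (fsuc x) fzero) (near k fzero (fsuc y)))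

-- In any graph this implies connectedness, and it holds in a connected graph once 2^k reaches the
-- largest distance; so it replaces connectedness, which is not first-order.
connectedWithin : ℕ → Formula 0
connectedWithin k = all' (all' (near k (fsuc fzero) fzero))

qr-near : ∀ {j} k {x y : Fin j} → qr (near k x y) ≤ k
qr-near zero    = z≤n
qr-near (suc k) = s≤s (⊔-lub (qr-near k) (qr-near k))

nest-near : ∀ {j} k {x y : Fin j} → Nests (Constant qE) (near k x y)
nest-near zero    = nests ([] ∷ [] ∷ [])
nest-near (suc k) = nest-ex (refl ∷_) (nest-conj (nest-near k) (nest-near k))

-- Paths and nonbacktracking walks.

module _ {n} (G : Graph n) where

  -- Recursion on the exact length makes existence decidable, so that a least length can be found by
  -- search.
  Path : ℕ → Fin n → Fin n → Set
  Path zero    u v = u ≡ v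
  Path (suc k) u v = ∃[ w ] (E G u w ≡ true × Path k w v)

  path? : ∀ k u v → Dec (Path k u v)
  path? zero    u v = u ≟ v
  path? (suc k) u v = anyFin? λ w → (E G u w ≟ᵇ true) ×-dec path? k w v

module _ {n} {G : Graph n} where

  E-sym : ∀ {u v} → E G u v ≡ true → E G v u ≡ true
  E-sym {u} {v} e = ≡.trans (Defs.sym G v u) e

  E⇒≢ : ∀ {u v} → E G u v ≡ true → u ≢ v
  E⇒≢ {u} e refl with ≡.trans (≡.sym e) (irrefl G u)
  ... | ()

  path-snoc : ∀ k {u v w} → Path G k u v → E G v w ≡ true → Path G (suc k) u w
  path-snoc zero    refl       e = _ , e , refl
  path-snoc (suc k) (x , e′ , p) e = x , e′ , path-snoc k p e

  path-sym : ∀ k {u v} → Path G k u v → Path G k v u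
  path-sym zero    refl        = refl
  path-sym (suc k) (w , e , p) = path-snoc k (path-sym k p) (E-sym e)

  -- The cut is made after `a` steps, or at the end point if the path is shorter than that.
  path-split : ∀ a b k {u v} → k ≤ a + b → Path G k u v →
    ∃[ w ] ∃[ i ] ∃[ j ] (i ≤ a × Path G i u w × j ≤ b × Path G j w v)
  path-split zero    b k       le p = _ , 0 , k , z≤n , refl , le , p
  path-split (suc a) b zero    le p = _ , 0 , 0 , z≤n , refl , z≤n , p
  path-split (suc a) b (suc k) (s≤s le) (x , e , p) with path-split a b k le p
  ... | w , i , j , i≤ , p₁ , j≤ , p₂ = w , suc i , j , s≤s i≤ , (x , e , p₁) , j≤ , p₂

  walk⇒path : ∀ {u v} → Walk G u v → ∃[ k ] Path G k u v
  walk⇒path here       = 0 , refl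
  walk⇒path (step e w) with walk⇒path w
  ... | k , p = suc k , _ , e , p

  walk-++ : ∀ {u v w} → Walk G u v → Walk G v w → Walk G u w
  walk-++ here       q = q
  walk-++ (step e p) q = step e (walk-++ p q)

  near⁺ : ∀ k {j} {ρ : Fin j → Fin n} {x y} i → i ≤ 2 ^ k → Path G i (ρ x) (ρ y) → Sat G ρ (near k x y)
  near⁺ zero    0             le       p              = disj⁺ (inj₁ (atEq⁺ p))
  near⁺ zero    1             le       (_ , e , refl) = disj⁺ (inj₂ (atE⁺ e))
  near⁺ zero    (suc (suc i)) (s≤s ()) p
  near⁺ (suc k) i le p
    with path-split (2 ^ k) (2 ^ k) i (≤-trans le (≤-reflexive (cong (2 ^ k +_) (+-identityʳ _)))) p
  ... | w , a , b , a≤ , p₁ , b≤ , p₂ = ex⁺ w (conj⁺ (near⁺ k a a≤ p₁) (near⁺ k b b≤ p₂))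

  near⁻ : ∀ k {j} {ρ : Fin j → Fin n} {x y} → Sat G ρ (near k x y) → Walk G (ρ x) (ρ y)
  near⁻ zero {ρ = ρ} {x} s with disj⁻ s
  ... | inj₁ t = subst (Walk G (ρ x)) (atEq⁻ t) here
  ... | inj₂ t = step (atE⁻ t) here
  near⁻ (suc k) s with ex⁻ s
  ... | w , t = let t₁ , t₂ = conj⁻ t in walk-++ (near⁻ k t₁) (near⁻ k t₂)

  -- Seg x y p q k: a nonbacktracking walk with first step x → y, last step p → q and k + 1 steps.
  data Seg : Fin n → Fin n → Fin n → Fin n → ℕ → Set where
    edge : ∀ {x y} → E G x y ≡ true → Seg x y x y 0
    cons : ∀ {x y z p q k} → E G x y ≡ true → x ≢ z → Seg y z p q k → Seg x y p q (suc k)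

  -- The walks overlap in the edge p → q. Hence no backtracking can arise at the joint, and the
  -- indices, each one less than the number of steps, simply add.
  seg-++ : ∀ {x y p q r s k l} → Seg x y p q k → Seg p q r s l → Seg x y r s (k + l)
  seg-++ (edge e)       t = t
  seg-++ (cons e x≢z s) t = cons e x≢z (seg-++ s t)

  first-edge : ∀ {x y p q k} → Seg x y p q k → E G x y ≡ true
  first-edge (edge e)     = e
  first-edge (cons e _ _) = e

  last-edge : ∀ {x y p q k} → Seg x y p q k → E G p q ≡ true
  last-edge (edge e)     = e
  last-edge (cons _ _ s) = last-edge s

  seg-snoc : ∀ {x y p q r k} → Seg x y p q k → E G q r ≡ true → p ≢ r → Seg x y q r (suc k)
  seg-snoc (edge e)       e′ p≢r = cons e p≢r (edge e′)
  seg-snoc (cons e x≢z s) e′ p≢r = cons e x≢z (seg-snoc s e′ p≢r)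

  seg-reverse : ∀ {x y p q k} → Seg x y p q k → Seg q p y x k
  seg-reverse (edge e)       = edge (E-sym e)
  seg-reverse (cons e x≢z s) = seg-snoc (seg-reverse s) (E-sym e) (x≢z ∘ ≡.sym)

  seg-init : ∀ {x y p q k} → Seg x y p q (suc k) → ∃[ o ] (Seg x y o p k × o ≢ q)
  seg-init (cons e x≢q (edge e′)) = _ , edge e , x≢q
  seg-init (cons e x≢z s@(cons _ _ _)) with seg-init s
  ... | o , s′ , o≢q = o , cons e x≢z s′ , o≢q

  tail : ∀ {x y p q k} → Seg x y p q k → List (Fin n)
  tail (edge {y = y} _)     = y ∷ []
  tail (cons {y = y} _ _ s) = y ∷ tail s

  last∈tail : ∀ {x y p q k} (s : Seg x y p q k) → q ∈ tail s
  last∈tail (edge _)     = here refl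
  last∈tail (cons _ _ s) = there (last∈tail s)

  length-tail : ∀ {x y p q k} (s : Seg x y p q k) → length (tail s) ≡ suc k
  length-tail (edge _)     = refl
  length-tail (cons _ _ s) = cong suc (length-tail s)

  chain-tail : ∀ {x y p q k} (s : Seg x y p q k) → Chain G (x ∷ tail s)
  chain-tail (edge e)              = e , tt
  chain-tail (cons e _ s@(edge _)) = e , chain-tail s
  chain-tail (cons e _ s@(cons _ _ _)) = e , chain-tail s

  chain-prefix : ∀ as {x bs} → Chain G (as ++ x ∷ bs) → Chain G (as ++ x ∷ [])
  chain-prefix []           c       = tt
  chain-prefix (a ∷ [])     (e , c) = e , tt
  chain-prefix (a ∷ b ∷ as) (e , c) = e , chain-prefix (b ∷ as) c

-- Nonbacktracking walks in acyclic graphs.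

unique-prefix : ∀ {A : Set} as {x : A} {bs} → Unique (as ++ x ∷ bs) → Unique (x ∷ as)
unique-prefix []       u = [] ∷ []
unique-prefix (a ∷ as) (a∉ ∷ u) with unique-prefix as u
... | x∉ ∷ u′ = ((λ x≡a → All.head (All.++⁻ʳ as a∉) (≡.sym x≡a)) ∷ x∉) ∷ All.++⁻ˡ as a∉ ∷ u′

lookup-injective : ∀ {A : Set} {xs : List A} → Unique xs → ∀ i j → lookup xs i ≡ lookup xs j → i ≡ j
lookup-injective (x∉ ∷ u) fzero    fzero    eq = refl
lookup-injective (x∉ ∷ u) fzero    (fsuc j) eq = ⊥-elim (All.lookup x∉ (∈-lookup j) eq)
lookup-injective (x∉ ∷ u) (fsuc i) fzero    eq = ⊥-elim (All.lookup x∉ (∈-lookup i) (≡.sym eq))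
lookup-injective (x∉ ∷ u) (fsuc i) (fsuc j) eq = cong fsuc (lookup-injective u i j eq)

unique⇒length≤ : ∀ {n} {xs : List (Fin n)} → Unique xs → length xs ≤ n
unique⇒length≤ u = injective⇒≤ λ {i} {j} → lookup-injective u i j

module Acyclic {n} {G : Graph n} (acyclic : ¬ HasCycle G) where

  -- A repetition in a nonbacktracking walk encloses a cycle.
  seg-unique : ∀ {x y p q k} (s : Seg {G = G} x y p q k) → Unique (x ∷ tail s)
  seg-unique (edge e) = (E⇒≢ {G = G} e ∷ []) ∷ [] ∷ []
  seg-unique {x} {y} (cons {z = z} e x≢z s) = All.tabulate distinct ∷ seg-unique s
    where
    distinct : ∀ {v} → v ∈ y ∷ tail s → x ≢ v
    distinct (here refl) = E⇒≢ {G = G} e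
    distinct (there v∈) refl with ∈-∃++ v∈
    -- A return to `x` right after `y` would be backtracking, because `tail s` starts with `z`.
    ... | [] , zs , eq = x≢z (≡.sym (first≡ s eq))
      where
      first≡ : ∀ {a b p q k} (t : Seg {G = G} a b p q k) {c zs} → tail t ≡ c ∷ zs → b ≡ c
      first≡ (edge _)     refl = refl
      first≡ (cons _ _ _) refl = refl
    -- For a later return, the vertices from `y` up to it are distinct by induction, and at least
    -- two of them precede the return: a cycle through `x`.
    ... | w ∷ ys , zs , eq = acyclic (x , y ∷ w ∷ ys , s≤s (s≤s z≤n)
      , unique-prefix (y ∷ w ∷ ys) (subst (λ l → Unique (y ∷ l)) eq (seg-unique s))
      , e , chain-prefix (y ∷ w ∷ ys) (subst (λ l → Chain G (y ∷ l)) eq (chain-tail s)))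

  seg-ends : ∀ {x y p q k} → Seg {G = G} x y p q k → x ≢ q
  seg-ends s = All.lookup (AllPairs.head (seg-unique s)) (last∈tail s)

  -- Pigeonhole: the k + 2 vertices of the walk are distinct.
  seg-bound : ∀ {x y p q k} → Seg {G = G} x y p q k → suc (suc k) ≤ n
  seg-bound s = subst (λ l → suc l ≤ n) (length-tail s) (unique⇒length≤ (seg-unique s))

-- Distances, branches and medians in a tree.

module Tree {n} (G : Graph n) (connected : Connected G) (acyclic : ¬ HasCycle G) where
  open Acyclic acyclic public

  -- Opaque, so that type checking never unfolds the search.
  abstract
    shortest : ∀ u v → ∃[ k ] (Path G k u v × (∀ i → Path G i u v → k ≤ i))
    shortest u v with walk⇒path (connected u v)
    ... | k , p = least (λ i → path? G i u v) k p

  dist : Fin n → Fin n → ℕ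
  dist u v = proj₁ (shortest u v)

  dist-path : ∀ u v → Path G (dist u v) u v
  dist-path u v = proj₁ (proj₂ (shortest u v))

  dist-min : ∀ {u v} k → Path G k u v → dist u v ≤ k
  dist-min {u} {v} = proj₂ (proj₂ (shortest u v))

  dist-sym : ∀ u v → dist u v ≡ dist v u
  dist-sym u v = ≤-antisym (dist-min _ (path-sym (dist v u) (dist-path v u)))
                           (dist-min _ (path-sym (dist u v) (dist-path u v)))

  dist≡0⇒≡ : ∀ {u v} → dist u v ≡ 0 → u ≡ v
  dist≡0⇒≡ {u} {v} eq with dist u v | dist-path u v
  dist≡0⇒≡ refl | .0 | p = p

  dist-edge : ∀ {u w} → E G u w ≡ true → ∀ v → dist u v ≤ suc (dist w v)
  dist-edge e v = dist-min _ (_ , e , dist-path _ v)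

  towards : ∀ {u v} → u ≢ v → ∃[ w ] (E G u w ≡ true × suc (dist w v) ≤ dist u v)
  towards {u} {v} u≢v with dist u v | dist-path u v
  ... | zero  | p         = contradiction p u≢v
  ... | suc k | w , e , p = w , e , s≤s (dist-min k p)

  -- Prepends y → a to a shortest path from `a` to `x`. The second vertex of that path is nearer to
  -- `x` than `a`, hence nearer than `y`, so the walk does not turn back. The number `k` only bounds
  -- the recursion.
  descend : ∀ k {x y a} → dist a x ≤ k → E G y a ≡ true → dist a x ≤ dist y x →
    ∃[ p ] Seg {G = G} y a p x (dist a x)
  descend k {x} {y} {a} ≤k e le with a ≟ x
  ... | yes refl = y , subst (Seg y a y a) (≡.sym (n≤0⇒n≡0 (dist-min 0 refl))) (edge e)
  descend zero    ≤k e le | no a≢x = contradiction (dist≡0⇒≡ (n≤0⇒n≡0 ≤k)) a≢x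
  descend (suc k) {x} {y} {a} ≤k e le | no a≢x with towards a≢x
  ... | a′ , e′ , lt with descend k (≤-pred (≤-trans lt ≤k)) e′ (≤-trans (n≤1+n _) lt)
  ...   | p , s = p , subst (Seg y a p x) (≤-antisym lt (dist-edge e′ x)) (cons e y≢a′ s)
    where
    y≢a′ : y ≢ a′
    y≢a′ refl = <⇒≱ lt le

  -- Two distinct such neighbours would close up, along shortest paths to x, to a nonbacktracking closed walk.
  parent-unique : ∀ {x y a b} → E G y a ≡ true → E G y b ≡ true →
    dist a x ≤ dist y x → dist b x ≤ dist y x → a ≡ b
  parent-unique {x} {y} {a} {b} ea eb la lb with a ≟ b
  ... | yes a≡b = a≡b
  ... | no a≢b with descend _ ≤-refl ea la | descend _ ≤-refl eb lb
  ...   | _ , s | _ , t = ⊥-elim (seg-ends (seg-++ (seg-snoc (seg-reverse t) ea (a≢b ∘ ≡.sym)) s) refl)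

  segment : ∀ {x y} → y ≢ x → ∃[ a ] ∃[ p ] (Seg {G = G} y a p x (dist a x) × suc (dist a x) ≡ dist y x)
  segment {x} y≢x with towards y≢x
  ... | a , e , lt with descend _ ≤-refl e (≤-trans (n≤1+n _) lt)
  ...   | p , s = a , p , s , ≤-antisym lt (dist-edge e x)

  -- A shortest path is nonbacktracking, so its dist y x + 1 vertices are distinct.
  dist<n : ∀ y x → dist y x < n
  dist<n y x with y ≟ x
  ... | yes refl = ≤-trans (s≤s (dist-min 0 refl)) (nonempty y)
    where
    nonempty : ∀ {m} → Fin m → 1 ≤ m
    nonempty fzero    = s≤s z≤n
    nonempty (fsuc _) = s≤s z≤n
  ... | no y≢x with segment y≢x
  ...   | a , p , s , eq = subst (_< n) eq (seg-bound s)

  -- The component of `u` in the tree with `v` removed, expressed through distances.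
  InBranch : Fin n → Fin n → Fin n → Set
  InBranch v u x = E G v u ≡ true × dist u x < dist v x

  inBranch? : ∀ v u x → Dec (InBranch v u x)
  inBranch? v u x = (E G v u ≟ᵇ true) ×-dec (dist u x <? dist v x)

  branch-unique : ∀ {v u u′ x} → InBranch v u x → InBranch v u′ x → u ≡ u′
  branch-unique (e , l) (e′ , l′) = parent-unique e e′ (<⇒≤ l) (<⇒≤ l′)

  branch-root : ∀ {v u} → ¬ InBranch v u v
  branch-root (e , l) = n≮0 (<-≤-trans l (dist-min 0 refl))

  -- If `y` is no farther from `u` than from `v`, then `u` is the neighbour of `v` towards `y`.
  -- Otherwise `y` coincides with the next vertex `z` from `x` towards `u`, although `y` is farther
  -- from `u` than `x` and `z` is nearer.
  branch-closed : ∀ {v u x y} → InBranch v u x → E G x y ≡ true → y ≢ v → InBranch v u y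
  branch-closed {v} {u} {x} {y} (e , l) exy y≢v with towards (y≢v ∘ ≡.sym) | dist u y ≤? dist v y
  ... | u′ , e′ , l′ | yes le = e , subst (λ w → dist w y < dist v y) (parent-unique e′ e (<⇒≤ l′) le) l′
  ... | _            | no  ≰  = ⊥-elim absurd
    where
    y<u : dist v y < dist u y
    y<u = ≰⇒> ≰
    uy≤ : dist u y ≤ suc (dist u x)
    uy≤ = ≤-trans (≤-reflexive (dist-sym u y))
         (≤-trans (dist-edge (E-sym {G = G} exy) u) (s≤s (≤-reflexive (dist-sym x u))))
    vx≤ : dist v x ≤ suc (dist v y)
    vx≤ = ≤-trans (≤-reflexive (dist-sym v x))
         (≤-trans (dist-edge exy v) (s≤s (≤-reflexive (dist-sym y v))))
    vy≤ : dist v y ≤ dist u x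
    vy≤ = ≤-pred (≤-trans y<u uy≤)
    far : dist v x ≤ dist u y
    far = ≤-trans vx≤ y<u
    x≢u : x ≢ u
    x≢u refl = y≢v (≡.sym (dist≡0⇒≡ (n≤0⇒n≡0 (≤-trans vy≤ (dist-min 0 refl)))))
    absurd : ⊥
    absurd with towards x≢u
    ... | z , exz , lz = <⇒≱ lz (≤-trans (≤-reflexive (dist-sym x u))
      (≤-trans (<⇒≤ l) (≤-trans far (≤-reflexive (≡.trans (dist-sym u y) (cong (λ w → dist w u) (≡.sym z≡y)))))))
      where
      -- Both y and the next vertex z on the way from x to u are parents of x in the tree rooted at v.
      z≡y : z ≡ y
      z≡y = parent-unique {x = v} exz exy
        (≤-trans (≤-reflexive (dist-sym z v)) (≤-trans (dist-edge e z)
          (≤-trans (s≤s (≤-reflexive (dist-sym u z))) (≤-trans lz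
          (≤-trans (≤-reflexive (dist-sym x u)) (≤-trans (<⇒≤ l) (≤-reflexive (dist-sym v x))))))))
        (≤-trans (≤-reflexive (dist-sym y v)) (≤-trans vy≤ (≤-trans (<⇒≤ l) (≤-reflexive (dist-sym v x)))))

  weight : (Fin n → Bool) → ℕ
  weight C = sum (indicator ∘ C)

  piece : (Fin n → Bool) → Fin n → Fin n → Fin n → Bool
  piece C v u x = C x ∧ ⌊ inBranch? v u x ⌋

  piece⁺ : ∀ {C v u x} → T (C x) → InBranch v u x → T (piece C v u x)
  piece⁺ x∈C b = from T-∧ (x∈C , fromWitness b)

  piece⁻ : ∀ C {v u} x → T (piece C v u x) → T (C x) × InBranch v u x
  piece⁻ C x x∈ = let x∈C , b = to (T-∧ {C x}) x∈ in x∈C , toWitness b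

  totalDist : (Fin n → Bool) → Fin n → ℕ
  totalDist C v = sum λ x → indicator (C x) * dist v x

  -- Moving from v to a neighbour u lowers dist · x by 1 in the branch of u and raises it by at most 1
  -- elsewhere, so no branch at a minimiser of the total distance carries more than half of the weight.
  median-halves : ∀ C {v} → (∀ u → totalDist C v ≤ totalDist C u) → ∀ u →
    weight (piece C v u) + weight (piece C v u) ≤ weight C
  median-halves C {v} minimal u = halves (E G v u ≟ᵇ true)
   where
   halves : Dec (E G v u ≡ true) → weight (piece C v u) + weight (piece C v u) ≤ weight C
   halves (no ¬e) = ≤-trans (+-mono-≤ none none) z≤n
    where
    zeroes : ∀ x → indicator (piece C v u x) ≡ 0
    zeroes x with C x | inBranch? v u x
    ... | false | _           = refl
    ... | true  | yes (e , _) = contradiction e ¬e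
    ... | true  | no _        = refl
    none : weight (piece C v u) ≤ 0
    none = ≤-reflexive (sum-zero zeroes)
   halves (yes e) = +-cancelˡ-≤ (totalDist C v) _ _ (begin
    totalDist C v + (weight P + weight P)
      ≤⟨ +-monoˡ-≤ _ (minimal u) ⟩
    totalDist C u + (weight P + weight P)
      ≡⟨ cong (totalDist C u +_) (∑-distrib-+ (indicator ∘ P) (indicator ∘ P)) ⟨
    totalDist C u + sum (λ x → indicator (P x) + indicator (P x))
      ≡⟨ ∑-distrib-+ (λ x → indicator (C x) * dist u x) (λ x → indicator (P x) + indicator (P x)) ⟨
    sum (λ x → indicator (C x) * dist u x + (indicator (P x) + indicator (P x)))
      ≤⟨ sum-mono-≤ pointwise ⟩
    sum (λ x → indicator (C x) * dist v x + indicator (C x))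
      ≡⟨ ∑-distrib-+ (λ x → indicator (C x) * dist v x) (indicator ∘ C) ⟩
    totalDist C v + weight C ∎)
    where
    open ≤-Reasoning
    P = piece C v u
    pointwise : ∀ x → indicator (C x) * dist u x + (indicator (P x) + indicator (P x))
                    ≤ indicator (C x) * dist v x + indicator (C x)
    pointwise x with C x | inBranch? v u x
    ... | false | _ = z≤n
    ... | true | yes (_ , l) = begin
      1 * dist u x + 2   ≡⟨ cong (_+ 2) (*-identityˡ (dist u x)) ⟩
      dist u x + 2       ≡⟨ +-suc (dist u x) 1 ⟩
      suc (dist u x) + 1 ≤⟨ +-monoˡ-≤ 1 l ⟩
      dist v x + 1       ≡⟨ cong (_+ 1) (*-identityˡ (dist v x)) ⟨
      1 * dist v x + 1   ∎
    ... | true | no _ = begin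
      1 * dist u x + 0   ≡⟨ ≡.trans (+-identityʳ _) (*-identityˡ (dist u x)) ⟩
      dist u x           ≤⟨ dist-edge (E-sym {G = G} e) x ⟩
      suc (dist v x)     ≡⟨ +-comm 1 (dist v x) ⟩
      dist v x + 1       ≡⟨ cong (_+ 1) (*-identityˡ (dist v x)) ⟨
      1 * dist v x + 1   ∎

-- Graph coverings

-- The condition at the single vertex `x` for `f` to be a covering map.
record LocalIso {n m} (G : Graph n) (H : Graph m) (f : Fin n → Fin m) (x : Fin n) : Set where
  field
    preserves : ∀ {y} → E G x y ≡ true → E H (f x) (f y) ≡ true
    injective : ∀ {y z} → E G x y ≡ true → E G x z ≡ true → f y ≡ f z → y ≡ z
    lifts     : ∀ {h} → E H (f x) h ≡ true → ∃[ y ] (E G x y ≡ true × f y ≡ h)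

-- Only the values at `x` and its neighbours matter; this is what allows gluing along branches.
localIso-cong : ∀ {n m} {G : Graph n} {H : Graph m} {f g x} → g x ≡ f x →
  (∀ {y} → E G x y ≡ true → g y ≡ f y) → LocalIso G H f x → LocalIso G H g x
localIso-cong {H = H} {f} {g} {x} gx gy iso = record
  { preserves = λ e → ≡.trans (cong₂ (E H) gx (gy e)) (preserves e)
  ; injective = λ e e′ eq → injective e e′ (≡.trans (≡.sym (gy e)) (≡.trans eq (gy e′)))
  ; lifts     = λ {h} e → let y , e′ , eq = lifts (≡.trans (cong (λ z → E H z h) (≡.sym gx)) e)
                          in y , e′ , ≡.trans (gy e′) eq
  }
  where open LocalIso iso

module Covering {n m} {G : Graph n} {H : Graph m} (f : Fin n → Fin m) (covering : ∀ x → LocalIso G H f x) where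
  open module LI x = LocalIso (covering x)

  surjective : ∀ {a h} x → f x ≡ a → Walk H a h → ∃[ y ] f y ≡ h
  surjective x eq here = x , eq
  surjective x refl (step e w) with lifts x e
  ... | y , _ , eq = surjective y eq w

  -- The image of the walk in `H` is lifted step by step from x′ → y′. If the lift turned back, then
  -- `x` and `z` would have the same image, and injectivity at `y` would make the original walk turn
  -- back.
  transfer : ∀ {x y p q k x′ y′} → f x ≡ f x′ → f y ≡ f y′ → E G x′ y′ ≡ true →
    Seg {G = G} x y p q k → ∃[ p′ ] ∃[ q′ ] Seg {G = G} x′ y′ p′ q′ k
  transfer fx fy e′ (edge e) = _ , _ , edge e′
  transfer {y = y} {y′ = y′} fx fy e′ (cons {z = z} e x≢z s)
    with lifts y′ (≡.trans (cong (λ a → E H a (f z)) (≡.sym fy)) (preserves y (first-edge s)))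
  ... | z′ , e″ , fz with transfer fy (≡.sym fz) e″ s
  ...   | p′ , q′ , s′ = p′ , q′ , cons e′ x′≢z′ s′
    where
    x′≢z′ : _ ≢ z′
    x′≢z′ refl = x≢z (injective y (E-sym {G = G} e) (first-edge s) (≡.trans fx fz))

  module _ (acyclic : ¬ HasCycle G) where
    open Acyclic acyclic

    -- Otherwise every nonbacktracking walk starting a → x lifts to one starting b → y, which extends the
    -- segment from a to b; iterating this gives arbitrarily long nonbacktracking walks in G.
    no-shift : ∀ {a x b y p k} → Seg {G = G} a x p b k → E G b y ≡ true → p ≢ y → f a ≡ f b → f x ≢ f y
    no-shift {a} {x} {b} {y} {p} {k} s e p≢y fa fx =
      let _ , _ , _ , le , t = unbounded n in <⇒≱ (≤-trans (n≤1+n _) (seg-bound t)) le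
      where
      unbounded : ∀ N → ∃[ N′ ] ∃[ q ] ∃[ r ] (N ≤ N′ × Seg {G = G} a x q r N′)
      unbounded zero = 0 , a , x , z≤n , edge (first-edge s)
      unbounded (suc N) with unbounded N
      ... | N′ , q , r , le , t with transfer fa fx e t
      ...   | q′ , r′ , t′ = _ , q′ , r′ , s≤s (m≤n⇒m≤o+n k le) , seg-++ (seg-snoc s e p≢y) t′

    -- Strong induction on length. One step is excluded since `H` has no loops, two steps by
    -- injectivity at the middle. For a longer walk, lift the image of its first edge to an edge b →
    -- y: if `y` is `p`, dropping both end edges leaves a shorter walk with equal images at its
    -- ends; otherwise `no-shift` applies.
    ends-differ : ∀ N {a x p b k} → k < N → Seg {G = G} a x p b k → f a ≢ f b
    ends-differ (suc N) lt (edge {x} {y} e) eq = E⇒≢ {G = H} (preserves x e) eq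
    ends-differ (suc N) lt (cons {y = y} e a≢b (edge e′)) eq = a≢b (injective y (E-sym {G = G} e) e′ eq)
    ends-differ (suc N) {a} {x} {p} {b} (s≤s lt) s@(cons e _ s₁@(cons _ _ _)) eq
      with lifts b (≡.trans (cong (λ c → E H c (f x)) (≡.sym eq)) (preserves a e)) | seg-init s₁
    ... | y , e′ , fy | _ , s₂ , _ = no-shift s e′ p≢y eq (≡.sym fy)
      where
      p≢y : p ≢ y
      p≢y refl = ends-differ N (≤-trans (n≤1+n _) lt) s₂ (≡.sym fy)

  module _ (tree : IsTree G) where
    open Tree G (proj₁ tree) (proj₂ tree) using (segment)

    injective′ : ∀ {a b} → f a ≡ f b → a ≡ b
    injective′ {a} {b} eq with a ≟ b
    ... | yes a≡b = a≡b
    ... | no a≢b with segment a≢b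
    ...   | _ , _ , s , _ = contradiction eq (ends-differ (proj₂ tree) _ ≤-refl s)

    covering⇒≅ : Fin n → Connected H → H ≅ G
    covering⇒≅ r connected = record { bij = mk↔ₛ′ g f (λ x → injective′ (fg (f x))) fg ; preserve = preserve }
      where
      g : Fin m → Fin n
      g h = proj₁ (surjective r refl (connected (f r) h))
      fg : ∀ h → f (g h) ≡ h
      fg h = proj₂ (surjective r refl (connected (f r) h))
      edges : ∀ x y → E H (f x) (f y) ≡ E G x y
      edges x y with E G x y in eq | E H (f x) (f y) in eq′
      ... | true  | true  = refl
      ... | false | false = refl
      ... | true  | false = ≡.trans (≡.sym eq′) (preserves x eq)
      -- The edge lifts to one from `x` to some `z` over `f y`, and `z` is `y` by global
      -- injectivity.
      ... | false | true with lifts x eq′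
      ...   | z , e , fz = ≡.trans (≡.sym (subst (λ z → E G x z ≡ true) (injective′ fz) e)) eq
      preserve : ∀ u v → E H u v ≡ E G (g u) (g v)
      preserve u v = ≡.trans (cong₂ (E H) (≡.sym (fg u)) (≡.sym (fg v))) (edges (g u) (g v))

-- The defining sentence.

sameEq : ∀ {m n} {a b : Fin m} {c d : Fin n} → ⌊ a ≟ b ⌋ ≡ ⌊ c ≟ d ⌋ → c ≡ d → a ≡ b
sameEq {a = a} {b} {c} {d} eq c≡d with a ≟ b | c ≟ d
... | yes a≡b | _ = a≡b
... | no _    | no c≢d = contradiction c≡d c≢d

module Definition {n} (G : Graph n) (tree : IsTree G) (d : ℕ) (deg≤d : ∀ v → deg G v ≤ d) (r : Fin n) where
  open Tree G (proj₁ tree) (proj₂ tree)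

  median : (Fin n → Bool) → Fin n
  median C = argmin (totalDist C) r (allFin n)

  median-minimal : ∀ C u → totalDist C (median C) ≤ totalDist C u
  median-minimal C u = All.lookup (f[argmin]≤f[xs] {f = totalDist C} r (allFin n)) (∈-allFin u)

  -- Padded with v, so that naming a vertex and its neighbours always takes d + 1 quantifiers.
  star : Fin n → Fin (suc d) → Fin n
  star v = v ◂ pad v (filterᵇ (E G v) (allFin n)) d

  star-neighbour : ∀ {v y} → E G v y ≡ true → ∃[ i ] star v i ≡ y
  star-neighbour {v} {y} e with ∈-pad {a = v} d (≤-trans (≤-reflexive (length-filterᵇ (E G v) (allFin n))) (deg≤d v))
                                 (∈-filter⁺ (T? ∘ E G v) (∈-allFin y) (from T-≡ e))
  ... | i , eq = fsuc i , eq

  -- The model-theoretic diagram of the tuple `ρ`. Equalities are recorded too, because padding and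
  -- later rounds may name a vertex repeatedly.
  diagram : ∀ {k} → (Fin k → Fin n) → Formula k
  diagram {k} ρ = ⋀ k λ i → ⋀ k λ j →
    conj (literal (E G (ρ i) (ρ j)) (atE i j)) (literal ⌊ ρ i ≟ ρ j ⌋ (atEq i j))

  isStar : ∀ k → Fin (suc d) → Formula (suc (suc d + k))
  isStar k i = atEq fzero (fsuc (i ↑ˡ k))

  -- An implication: `fsuc fzero` is the centre of the latest star, and non-adjacency to it is the
  -- base of the disjunction.
  closedStar : ∀ k → Formula (suc d + k)
  closedStar k = all' (⋁ (neg (atE fzero (fsuc fzero))) (suc d) (isStar k))

  -- Variable i of a subformula stands for the vertex ρ i of G.
  cover : ℕ → (Fin n → Bool) → ∀ {k} → (Fin k → Fin n) → Formula k
  coverBody : ℕ → (Fin n → Bool) → ∀ {k} → (Fin k → Fin n) → Formula (suc d + k)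

  -- Level `ℓ` is meant for weight below 2^ℓ, so at level 0 the set `C` is empty.
  cover zero    C ρ = ⊤'
  cover (suc ℓ) C {k} ρ = exs (suc d) (coverBody ℓ C ρ)

  coverBody ℓ C {k} ρ = conj (diagram ρ′) (conj (closedStar k) (⋀ n λ u → cover ℓ (piece C (median C) u) ρ′))
    where
    ρ′ = extend (star (median C)) ρ

  diagram-self : ∀ {k} (ρ : Fin k → Fin n) → Sat G ρ (diagram ρ)
  diagram-self {k} ρ = ⋀⁺ k λ i → ⋀⁺ k λ j → conj⁺ (literal⁺ {φ = atE i j} refl) (literal⁺ {φ = atEq i j} refl)

  diagram⁻ : ∀ {m k} {H : Graph m} {τ : Fin k → Fin m} {ρ} → Sat H τ (diagram ρ) → ∀ i j →
    E H (τ i) (τ j) ≡ E G (ρ i) (ρ j) × ⌊ τ i ≟ τ j ⌋ ≡ ⌊ ρ i ≟ ρ j ⌋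
  diagram⁻ {k = k} {ρ = ρ} s i j with conj⁻ (⋀⁻ k (⋀⁻ k s i) j)
  ... | t , u = literal⁻ (E G (ρ i) (ρ j)) {atE i j} t , literal⁻ ⌊ ρ i ≟ ρ j ⌋ {atEq i j} u

  module _ {m k} {H : Graph m} {τ : Fin (suc d + k) → Fin m} where

    closedStar⁺ : (∀ h → E H h (τ fzero) ≡ true → ∃[ i ] h ≡ τ (i ↑ˡ k)) → Sat H τ (closedStar k)
    closedStar⁺ closed = all'⁺ named
      where
      named : ∀ h → Sat H (h ◂ τ) (⋁ (neg (atE fzero (fsuc fzero))) (suc d) (isStar k))
      named h with E H h (τ fzero) in eq
      ... | true  = let i , h≡ = closed h eq in ⋁⁺ (suc d) {isStar k} i (atEq⁺ h≡)
      ... | false = ⋁⁺₀ (suc d) {isStar k} (literal⁺ {b = false} {atE fzero (fsuc fzero)} eq)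

    closedStar⁻ : Sat H τ (closedStar k) → ∀ {h} → E H h (τ fzero) ≡ true → ∃[ i ] h ≡ τ (i ↑ˡ k)
    closedStar⁻ s {h} e with ⋁⁻ (suc d) {isStar k} (all'⁻ s h)
    ... | inj₁ t with () ← ≡.trans (≡.sym e) (literal⁻ false {atE fzero (fsuc fzero)} t)
    ... | inj₂ (i , t) = i , atEq⁻ {i = fzero} {fsuc (i ↑ˡ k)} t

  cover-self : ∀ ℓ C {k} (ρ : Fin k → Fin n) → Sat G ρ (cover ℓ C ρ)
  cover-self zero    C {k} ρ = ⊤'⁺
  cover-self (suc ℓ) C {k} ρ = exs⁺ (suc d) (star v)
    (conj⁺ (diagram-self ρ′) (conj⁺ (closedStar⁺ closed) (⋀⁺ n λ u → cover-self ℓ (piece C v u) ρ′)))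
    where
    v = median C
    ρ′ = extend (star v) ρ
    closed : ∀ y → E G y v ≡ true → ∃[ i ] y ≡ ρ′ (i ↑ˡ k)
    closed y e with star-neighbour (E-sym {G = G} e)
    ... | i , eq = i , ≡.sym (≡.trans (extend-↑ˡ (star v) ρ i) eq)

  -- Extracting a covering map from the sentence.

  Boundary : (Fin n → Bool) → ∀ {k} → (Fin k → Fin n) → Set
  Boundary C ρ = ∀ {x y} → T (C x) → E G x y ≡ true → T (C y) ⊎ (∃[ i ] ρ i ≡ y)

  Functional : ∀ {m k} → (Fin k → Fin n) → (Fin k → Fin m) → Set
  Functional ρ τ = ∀ i j → ρ i ≡ ρ j → τ i ≡ τ j

  module _ {m} (H : Graph m) (h₀ : Fin m) where

    -- The map is total, but constrained only around `C` and on the named vertices. Prescribing the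
    -- latter makes the maps for different branches agree at their common centre.
    record PartialCovering (C : Fin n → Bool) {k} (ρ : Fin k → Fin n) (τ : Fin k → Fin m) : Set where
      field
        f        : Fin n → Fin m
        extends  : ∀ i → f (ρ i) ≡ τ i
        localIso : ∀ x → T (C x) → LocalIso G H f x

    empty-covering : ∀ {C k} {ρ : Fin k → Fin n} {τ} → Functional ρ τ → weight C < 1 →
      PartialCovering C ρ τ
    empty-covering {C} {k} {ρ} {τ} functional C<1 = record
      { f        = f
      ; extends  = extends
      ; localIso = λ x x∈C → contradiction
          (≤-trans (≤-reflexive (≡.sym (cong indicator (to T-≡ x∈C)))) (f≤sum (indicator ∘ C) x)) (<⇒≱ C<1)
      }
      where
      f : Fin n → Fin m
      f x with anyFin? (λ i → ρ i ≟ x)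
      ... | yes (i , _) = τ i
      -- An arbitrary value away from the named vertices.
      ... | no _        = h₀
      extends : ∀ i → f (ρ i) ≡ τ i
      extends i with anyFin? (λ j → ρ j ≟ ρ i)
      ... | yes (j , eq) = functional j i eq
      ... | no none      = contradiction (i , refl) none

    module Glue {C k} {v} {ρ : Fin k → Fin n} {τ : Fin k → Fin m} {i₀ : Fin k} (ρi₀ : ρ i₀ ≡ v)
      (F : ∀ u → PartialCovering (piece C v u) ρ τ) where

      part : Fin n → Fin n → Fin m
      part u = PartialCovering.f (F u)

      part-extends : ∀ u i → part u (ρ i) ≡ τ i
      part-extends u = PartialCovering.extends (F u)

      branch : ∀ {x} → x ≢ v → ∃[ u ] InBranch v u x
      branch x≢v with towards (x≢v ∘ ≡.sym)
      ... | u , e , l = u , e , l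

      f : Fin n → Fin m
      f x with x ≟ v
      ... | yes _  = τ i₀
      ... | no x≢v = part (proj₁ (branch x≢v)) x

      f-centre : f v ≡ τ i₀
      f-centre with v ≟ v
      ... | yes _  = refl
      ... | no v≢v = contradiction refl v≢v

      f-branch : ∀ {u x} → InBranch v u x → f x ≡ part u x
      f-branch {u} {x} b with x ≟ v
      ... | yes refl = contradiction b branch-root
      ... | no x≢v   = cong (λ w → part w x) (branch-unique (proj₂ (branch x≢v)) b)

      f-extends : Functional ρ τ → ∀ i → f (ρ i) ≡ τ i
      f-extends functional i with ρ i ≟ v
      ... | yes eq  = functional i₀ i (≡.trans ρi₀ (≡.sym eq))
      ... | no ρi≢v = part-extends (proj₁ (branch ρi≢v)) i

      -- Each neighbour of `x` lies in the same branch or is `v`. In both cases `f` agrees with the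
      -- part for that branch, at `v` because `v` is named.
      f-iso : ∀ {x} → T (C x) → x ≢ v → LocalIso G H f x
      f-iso {x} x∈C x≢v with branch x≢v
      ... | u , b = localIso-cong (f-branch b) near-x (PartialCovering.localIso (F u) x (piece⁺ {C} x∈C b))
        where
        near-x : ∀ {y} → E G x y ≡ true → f y ≡ part u y
        near-x {y} e with y ≟ v
        ... | yes refl = ≡.trans (≡.sym (part-extends u i₀)) (cong (part u) ρi₀)
        ... | no y≢v   = cong (λ w → part w y) (branch-unique (proj₂ (branch y≢v)) (branch-closed b e y≢v))

    module Step {C k} {ρ : Fin k → Fin n} {τ : Fin k → Fin m} (boundary : Boundary C ρ)
      {v} {σ : Fin (suc d) → Fin m} (satDiagram : Sat H (extend σ τ) (diagram (extend (star v) ρ)))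
      (satClosed : Sat H (extend σ τ) (closedStar k)) where

      ρ′ : Fin (suc d + k) → Fin n
      ρ′ = extend (star v) ρ

      τ′ : Fin (suc d + k) → Fin m
      τ′ = extend σ τ

      partialIso : ∀ i j → E H (τ′ i) (τ′ j) ≡ E G (ρ′ i) (ρ′ j) × ⌊ τ′ i ≟ τ′ j ⌋ ≡ ⌊ ρ′ i ≟ ρ′ j ⌋
      partialIso = diagram⁻ {ρ = ρ′} satDiagram

      functional′ : Functional ρ′ τ′
      functional′ i j = sameEq (proj₂ (partialIso i j))

      faithful : ∀ i j → τ′ i ≡ τ′ j → ρ′ i ≡ ρ′ j
      faithful i j = sameEq (≡.sym (proj₂ (partialIso i j)))

      named : ∀ {y} → E G v y ≡ true → ∃[ i ] ρ′ i ≡ y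
      named e with star-neighbour e
      ... | i , eq = i ↑ˡ k , ≡.trans (extend-↑ˡ (star v) ρ i) eq

      boundary′ : ∀ u → Boundary (piece C v u) ρ′
      boundary′ u {x} {y} x∈ e with y ≟ v
      ... | yes refl = inj₂ (fzero , refl)
      ... | no y≢v with piece⁻ C x x∈
      ...   | x∈C , b with boundary x∈C e
      ...     | inj₁ y∈C = inj₁ (piece⁺ {C} y∈C (branch-closed b e y≢v))
      ...     | inj₂ (i , eq) = inj₂ (suc d ↑ʳ i , ≡.trans (extend-↑ʳ (suc d) (star v) ρ i) eq)

      module _ (F : ∀ u → PartialCovering (piece C v u) ρ′ τ′) where
        open Glue {C} {v = v} {ρ′} {τ′} {fzero} refl F

        extends′ : ∀ i → f (ρ′ i) ≡ τ′ i
        extends′ = f-extends functional′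

        extends : ∀ i → f (ρ i) ≡ τ i
        extends i = ≡.trans (cong f (≡.sym (extend-↑ʳ (suc d) (star v) ρ i)))
                   (≡.trans (extends′ (suc d ↑ʳ i)) (extend-↑ʳ (suc d) σ τ i))

        -- All neighbours of `v` are named, so `diagram` gives preservation and injectivity;
        -- `closedStar` leaves no further neighbour in `H` that would need a lift.
        centre-iso : LocalIso G H f v
        centre-iso = record { preserves = preserves ; injective = injective ; lifts = lifts }
          where
          preserves : ∀ {y} → E G v y ≡ true → E H (f v) (f y) ≡ true
          preserves e with named e
          ... | i , refl = ≡.trans (cong₂ (E H) f-centre (extends′ i)) (≡.trans (proj₁ (partialIso fzero i)) e)
          injective : ∀ {y z} → E G v y ≡ true → E G v z ≡ true → f y ≡ f z → y ≡ z
          injective e e′ eq with named e | named e′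
          ... | i , refl | j , refl = faithful i j (≡.trans (≡.sym (extends′ i)) (≡.trans eq (extends′ j)))
          lifts : ∀ {h} → E H (f v) h ≡ true → ∃[ y ] (E G v y ≡ true × f y ≡ h)
          lifts {h} e with closedStar⁻ satClosed (E-sym {G = H} (≡.trans (cong (λ a → E H a h) (≡.sym f-centre)) e))
          ... | i , refl = ρ′ (i ↑ˡ k)
            , ≡.trans (≡.sym (proj₁ (partialIso fzero (i ↑ˡ k)))) (≡.trans (cong (λ a → E H a h) (≡.sym f-centre)) e)
            , extends′ (i ↑ˡ k)

        localIso : ∀ x → T (C x) → LocalIso G H f x
        localIso x x∈C with x ≟ v
        ... | yes refl = centre-iso
        ... | no x≢v   = f-iso x∈C x≢v

        glued : PartialCovering C ρ τ
        glued = record { f = f ; extends = extends ; localIso = localIso }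

    cover-sound : ∀ ℓ C {k} (ρ : Fin k → Fin n) (τ : Fin k → Fin m) → Functional ρ τ → Boundary C ρ →
      weight C < 2 ^ ℓ → Sat H τ (cover ℓ C ρ) → PartialCovering C ρ τ
    cover-sound zero    C ρ τ functional boundary small s = empty-covering functional small
    cover-sound (suc ℓ) C {k} ρ τ functional boundary small s = glued λ u →
      cover-sound ℓ (piece C v u) ρ′ τ′ functional′ (boundary′ u) (small′ u) (⋀⁻ n (proj₂ rest) u)
      where
      v = median C
      named-body = exs⁻ (suc d) {φ = coverBody ℓ C ρ} s
      rest = conj⁻ (proj₂ (conj⁻ (proj₂ named-body)))
      open Step {C} {ρ = ρ} {τ} boundary {v} {proj₁ named-body} (proj₁ (conj⁻ (proj₂ named-body))) (proj₁ rest)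
      small′ : ∀ u → weight (piece C v u) < 2 ^ ℓ
      -- A branch of weight at least 2^ℓ would by halving force weight 2^(ℓ+1) on `C`.
      small′ u = ≰⇒> λ big → <⇒≱ small
        (≤-trans (+-mono-≤ big (≤-trans (≤-reflexive (+-identityʳ _)) big)) (median-halves C (median-minimal C) u))

  -- Rank, alternation and correctness of the sentence.

  qr-diagram : ∀ {k} (ρ : Fin k → Fin n) → qr (diagram ρ) ≤ 1
  qr-diagram {k} ρ = qr-⋀ k ≤-refl λ i → qr-⋀ k ≤-refl λ j →
    ⊔-lub (≤-trans (≤-reflexive (qr-literal (E G (ρ i) (ρ j)))) z≤n)
          (≤-trans (≤-reflexive (qr-literal ⌊ ρ i ≟ ρ j ⌋)) z≤n)

  qr-closedStar : ∀ k → qr (closedStar k) ≤ 1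
  qr-closedStar k = s≤s (qr-⋁ {β = neg (atE fzero (fsuc fzero))} (suc d) {isStar k} z≤n λ _ → z≤n)

  -- Each round adds d + 1 nested quantifiers. The conjuncts beside the next round have rank at most
  -- 1, so the summand 1 is paid only once.
  qr-cover : ∀ ℓ C {k} (ρ : Fin k → Fin n) → qr (cover ℓ C ρ) ≤ suc (ℓ * suc d)
  qr-cover zero    C ρ = ≤-refl
  qr-cover (suc ℓ) C {k} ρ = begin
    qr (exs (suc d) (coverBody ℓ C ρ)) ≡⟨ qr-exs (suc d) (coverBody ℓ C ρ) ⟩
    suc d + qr (coverBody ℓ C ρ)       ≤⟨ +-monoʳ-≤ (suc d) (⊔-lub (≤-trans (qr-diagram ρ′) (s≤s z≤n))
      (⊔-lub (≤-trans (qr-closedStar k) (s≤s z≤n)) (qr-⋀ n (s≤s z≤n) λ u → qr-cover ℓ (piece C (median C) u) ρ′))) ⟩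
    suc d + suc (ℓ * suc d)            ≡⟨ +-suc (suc d) (ℓ * suc d) ⟩
    suc (suc ℓ * suc d)                ∎
    where
    open ≤-Reasoning
    ρ′ = extend (star (median C)) ρ

  nest-diagram : ∀ {P : List Q → Set} {k} → P (qA ∷ []) → P [] → (ρ : Fin k → Fin n) → Nests P (diagram ρ)
  nest-diagram {k = k} pA p ρ = nest-⋀ k pA λ i → nest-⋀ k pA λ j →
    nest-conj (nest-atE {x = i} {j} (E G (ρ i) (ρ j)) p) (nest-atEq {x = i} {j} ⌊ ρ i ≟ ρ j ⌋ p)

  -- Rounds are nested only below existential quantifiers; every universal quantifier sits in a
  -- conjunct with no quantifier beneath it.
  nest-cover : ∀ ℓ C {k} (ρ : Fin k → Fin n) → Nests (TwoBlocks qE qA) (cover ℓ C ρ)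
  nest-cover zero    C ρ = nests (base (refl ∷ []) ∷ [])
  nest-cover (suc ℓ) C {k} ρ = nest-exs (suc d) {φ = coverBody ℓ C ρ} (refl ∷_)
    (nest-conj (nest-diagram (base (refl ∷ [])) (base []) ρ′)
    (nest-conj (nest-all' {R = Constant qA} (λ w → base (refl ∷ w))
        (nest-⋁ (suc d) {isStar k} (nest-atE false []) λ _ → nest-atEq true []))
      (nest-⋀ n (base (refl ∷ [])) λ u → nest-cover ℓ (piece C (median C) u) ρ′)))
    where
    ρ′ = extend (star (median C)) ρ

  -- Meant for `n < 2 ^ suc L`: then `L + 1` halvings exhaust the vertex set, and all distances in
  -- the tree are below 2^(L+1).
  sentence : ℕ → Formula 0
  sentence L = conj (cover (suc L) (λ _ → true) noVars) (connectedWithin (suc L))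

  altNum-sentence : ∀ L → altNum (sentence L) ≤ 1
  altNum-sentence L = altNum≤ {φ = sentence L} (nest-conj
    (nest-map alternations-TwoBlocks (nest-cover (suc L) _ noVars))
    (nest-map alternations-TwoBlocks connectedBlocks))
    where
    connectedBlocks : Nests (TwoBlocks qA qE) (connectedWithin (suc L))
    connectedBlocks = nest-all' {R = TwoBlocks qA qE} (refl ∷_)
      (nest-all' {R = Constant qE} (λ w → refl ∷ base w) (nest-near (suc L)))

  sentence-self : ∀ L → n < 2 ^ suc L → Sat G noVars (sentence L)
  sentence-self L n< = conj⁺ (cover-self (suc L) _ noVars) (all'⁺ λ u → all'⁺ λ v →
    near⁺ (suc L) (dist u v) (<⇒≤ (<-trans (dist<n u v) n<)) (dist-path u v))

  sentence-sound : ∀ L → n < 2 ^ suc L → ∀ {m} (H : Graph m) → Sat H noVars (sentence L) → H ≅ G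
  sentence-sound L n< {m} H s = Covering.covering⇒≅ f (λ x → localIso x tt) tree r connected
    where
    cov = proj₁ (conj⁻ s)
    h₀ : Fin m
    -- The centre named in the first round shows that `H` has a vertex.
    h₀ = proj₁ (exs⁻ (suc d) cov) fzero
    weight≡ : ∀ k → sum {k} (λ _ → 1) ≡ k
    weight≡ zero    = refl
    weight≡ (suc k) = cong suc (weight≡ k)
    open PartialCovering (cover-sound H h₀ (suc L) (λ _ → true) noVars noVars (λ ()) (λ _ _ → inj₁ tt)
      (subst (_< 2 ^ suc L) (≡.sym (weight≡ n)) n<) cov)
    connected : Connected H
    connected u v = near⁻ (suc L) (all'⁻ (all'⁻ (proj₂ (conj⁻ s)) u) v)

  -- The covering part has rank at most 1 + (L + 1)(d + 1), which is exactly `L` below the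
  -- right-hand side; strictness comes from `1 ≤ L`.
  qr-sentence : ∀ L → 1 ≤ L → 1 ≤ d → qr (sentence L) < (d + 1) * L + L + (d + 2)
  qr-sentence L 1≤L 1≤d = begin-strict
    qr (sentence L)             ≤⟨ ⊔-lub (qr-cover (suc L) _ noVars) (s≤s (s≤s (≤-trans (qr-near (suc L)) conn≤))) ⟩
    suc (suc L * suc d)         <⟨ m<n+m _ 1≤L ⟩
    L + suc (suc L * suc d)     ≡⟨ solve 2 (λ L d → L :+ (con 1 :+ (con 1 :+ L) :* (con 1 :+ d))
                                     := (d :+ con 1) :* L :+ L :+ (d :+ con 2)) refl L d ⟩
    (d + 1) * L + L + (d + 2)   ∎
    where
    open ≤-Reasoning
    conn≤ : suc L ≤ d + L * suc d
    conn≤ = +-mono-≤ 1≤d (m≤m*n L (suc d))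

-- The logarithmic bound.

1≤log : ∀ {n} L → 2 ≤ n → n < 2 ^ suc L → 1 ≤ L
1≤log zero    2≤n n<2 = contradiction n<2 (≤⇒≯ 2≤n)
1≤log (suc L) _   _   = s≤s z≤n

theorem4p1 : (d : ℕ) → 2 ≤ d → (n : ℕ) → (G : Graph n) → IsTree G → MaxDegree G d →
    ∃[ Φ ] (altNum Φ ≤ 2 × Defines Φ G × BelowBound d n (qr Φ))
theorem4p1 d 2≤d zero G tree ((() , _) , _)
-- A single vertex has degree 0, contradicting `2 ≤ d`; so `n` is at least 2 below and `L` is
-- positive.
theorem4p1 d 2≤d 1 G tree ((fzero , deg≡d) , _) rewrite irrefl G fzero =
  contradiction (≤-trans 2≤d (≤-reflexive (≡.sym deg≡d))) λ ()
theorem4p1 d 2≤d n@(suc (suc _)) G tree (_ , deg≤d) with binaryLog n (s≤s z≤n)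
... | L , lo , hi = sentence L
  , ≤-trans (altNum-sentence L) (n≤1+n 1)
  , (to T-≡ (holds (sentence-self L hi)) , λ m H s → sentence-sound L hi H (sat (from T-≡ s)))
  -- The integer `L`, the floor of log n, bounds both logarithms from below: the one to base 3/2 is
  -- at least the one to base 2, since 3^L ≤ 4^L.
  , L , L , 1 , ≤-refl
  , 3^L≤
  , lo¹
  , rank
  where
  open Definition G tree d deg≤d fzero
  lo¹ : 2 ^ L ≤ n ^ 1
  lo¹ = ≤-trans lo (≤-reflexive (≡.sym (*-identityʳ n)))
  3^L≤ : 3 ^ L ≤ n ^ 1 * 2 ^ L
  3^L≤ = begin
    3 ^ L             ≤⟨ ^-monoˡ-≤ L (n≤1+n 3) ⟩
    4 ^ L             ≡⟨ ^-*-assoc 2 2 L ⟩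
    2 ^ (L + (L + 0)) ≡⟨ cong (λ k → 2 ^ (L + k)) (+-identityʳ L) ⟩
    2 ^ (L + L)       ≡⟨ ^-distribˡ-+-* 2 L L ⟩
    2 ^ L * 2 ^ L     ≤⟨ *-monoˡ-≤ (2 ^ L) lo¹ ⟩
    n ^ 1 * 2 ^ L     ∎
    where open ≤-Reasoning
  1≤L : 1 ≤ L
  1≤L = 1≤log L (s≤s (s≤s z≤n)) hi
  rank : qr (sentence L) * 1 < (d + 1) * L + L + (d + 2) * 1
  rank = begin-strict
    qr (sentence L) * 1             ≡⟨ *-identityʳ _ ⟩
    qr (sentence L)                 <⟨ qr-sentence L 1≤L (≤-trans (n≤1+n 1) 2≤d) ⟩
    (d + 1) * L + L + (d + 2)       ≡⟨ cong ((d + 1) * L + L +_) (*-identityʳ (d + 2)) ⟨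
    (d + 1) * L + L + (d + 2) * 1   ∎
    where open ≤-Reasoning
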